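{- Let $T$ be a tree of order $n\ge 2$, rooted at a vertex, with vertex set $\{1,2,\ldots,n\}$ labelled so that the root is $1$ and $d(1,i)\le d(1,j)$ whenever $i<j$, and let $\mathrm{parent}[1\ldots n]$ be its parent array. Let $S=\{i\in\{1,\ldots,n\} : \mathrm{InPD}[i]=\text{true}\}$ be the set produced by Algorithm TREE PAIRED DOMINATION on input $T$. Then $S$ is a $\gamma_{\rm pr}$-set of $T$, i.e. $S$ is a paired dominating set of $T$ with $|S|=\gamma_{\rm pr}(T)$.
   Context: A paired dominating set (PD-set) of a graph $G$ without isolated vertices is a set $S\subseteq V(G)$ such that every vertex of $V(G)\setminus S$ is adjacent to some vertex of $S$ and the induced subgraph $G[S]$ contains a perfect matching (not necessarily induced). The paired domination number $\gamma_{\rm pr}(G)$ is the minimum cardinality of a PD-set of $G$; a $\gamma_{\rm pr}$-set is a PD-set of cardinality $\gamma_{\rm pr}(G)$. $d(u,v)$ denotes graph distance. For $i\neq 1$, $\mathrm{parent}[i]$ is the neighbour of $i$ on the path from $i$ to the root $1$; by convention there is a dummy vertex $0$ with $\mathrm{parent}[1]=\mathrm{parent}[0]=0$. Algorithm TREE PAIRED DOMINATION (input: a rooted tree $T$ of order $n\ge 2$ with vertex set $\{1,2,\ldots,n\}$, labelled so that the root is $1$ and $d(1,i)\le d(1,j)$ whenever $i<j$, given by its parent array $\mathrm{parent}[1\ldots n]$; it maintains boolean arrays $\mathrm{InPD}[0..n]$ and $\mathrm{DomByChild}[0..n]$): 1. Initialise $\mathrm{InPD}[i]=\mathrm{DomByChild}[i]=\text{false}$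 for all $i=0,\ldots,n$. 2. For $i=n,n-1,\ldots,2$ in this order, write $p=\mathrm{parent}[i]$, $g=\mathrm{parent}[p]$, and do (a) and then (b): (a) If $\mathrm{DomByChild}[i]=\text{false}$ and $\mathrm{InPD}[p]=\text{false}$ and $p\ne 1$ and $\mathrm{InPD}[g]=\text{false}$, then set $\mathrm{InPD}[p]$, $\mathrm{InPD}[g]$, $\mathrm{DomByChild}[g]$ and $\mathrm{DomByChild}[\mathrm{parent}[g]]$ to true. (b) If (with the current values) $\mathrm{DomByChild}[i]=\text{false}$ and $\mathrm{InPD}[p]=\text{false}$ and ($p=1$ or $\mathrm{InPD}[g]=\text{true}$), then set $\mathrm{InPD}[p]=\text{true}$, and, letting $i_1$ be the child of $p$ of largest label with $\mathrm{InPD}[i_1]=\text{false}$, set $\mathrm{InPD}[i_1]=\text{true}$ and $\mathrm{DomByChild}[p]=\text{true}$. 3. After the loop: if $\mathrm{DomByChild}[1]=\text{false}$, set $\mathrm{InPD}[1]$, $\mathrm{InPD}[2]$ and $\mathrm{DomByChild}[1]$ to true. The output is the array $\mathrm{InPD}$. -}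

module Defs where

open import Data.Bool.Base using (Bool; true; false; if_then_else_; not; _∧_; _∨_)
import Data.Bool.Properties as Bool
open import Data.Fin.Base using (Fin; zero; suc; _<_)
open import Data.Fin.Properties using (_≟_)
open import Data.Fin.Subset using (Subset; _∈_; _∉_; ∣_∣)
open import Data.List.Base using (List; []; _∷_; foldr; tabulate; filter; last)
import Data.List.Membership.Propositional as List
open import Data.List.Relation.Unary.Unique.Propositional using (Unique)
open import Data.Maybe.Base using (Maybe; just; nothing)
open import Data.Nat.Base using (ℕ; zero; suc; _≤_)
open import Data.Product.Base using (Σ; ∃; ∃-syntax; _×_; _,_; proj₁)
open import Data.Product using (∃!)
open import Data.Vec.Base using (Vec; _∷_; lookup; replicate; tail; _[_]≔_)
open import Function.Base using (_on_)
open import Level using (0ℓ)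
open import Relation.Binary.Core using (Rel)
open import Relation.Binary.Construct.Closure.ReflexiveTransitive using (Star; ε; _◅_)
open import Relation.Binary.Definitions using (Symmetric)
open import Relation.Binary.PropositionalEquality.Core using (_≡_; _≢_)
open import Relation.Nullary.Decidable using (⌊_⌋; _×-dec_)
open import Relation.Nullary.Negation using (¬_)

IsMinimum : ∀ {ℓ} → (ℕ → Set ℓ) → ℕ → Set ℓ
IsMinimum P k = P k × (∀ {j} → P j → k ≤ j)

record SimpleGraph (V : Set) : Set₁ where
  infix 4 _~_
  field
    _~_      : Rel V 0ℓ
    ~-sym    : Symmetric _~_
    ~-irrefl : ∀ {v} → ¬ (v ~ v)

  Walk : Rel V 0ℓ
  Walk = Star _~_

  length : ∀ {u v} → Walk u v → ℕ
  length ε       = 0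
  length (_ ◅ w) = suc (length w)

  vertices : ∀ {u v} → Walk u v → List V
  vertices {u} ε       = u ∷ []
  vertices {u} (_ ◅ w) = u ∷ vertices w

  IsPath : ∀ {u v} → Walk u v → Set
  IsPath w = Unique (vertices w)

  Connected : Set
  Connected = ∀ u v → Walk u v

  -- A cycle is a path with at least three vertices together with an edge
  -- joining its ends.
  Acyclic : Set
  Acyclic = ∀ {u v} (w : Walk u v) → IsPath w → 2 ≤ length w → ¬ (v ~ u)

  IsTree : Set
  IsTree = Connected × Acyclic

  -- `IsDistance u v k` states d(u,v) = k.
  IsDistance : V → V → ℕ → Set
  IsDistance u v = IsMinimum (λ k → ∃[ w ] length {u} {v} w ≡ k)

  -- p is a neighbour of i lying on the path from i to r.
  IsParent : (r i p : V) → Set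
  IsParent r i p = i ~ p × Σ (Walk i r) λ w → IsPath w × p List.∈ vertices w

  -- The edge set M of the matching is given as a symmetric subrelation of
  -- adjacency; it is perfect if every vertex is on exactly one edge of M.
  record PerfectMatching : Set₁ where
    field
      M       : Rel V 0ℓ
      M-sym   : Symmetric M
      M⊆~     : ∀ {u v} → M u v → u ~ v
      perfect : ∀ v → ∃! _≡_ (M v)

module _ {n : ℕ} (G : SimpleGraph (Fin n)) where
  open SimpleGraph G

  induced : (S : Subset n) → SimpleGraph (∃[ v ] v ∈ S)
  induced S = record
    { _~_      = _~_ on proj₁
    ; ~-sym    = ~-sym
    ; ~-irrefl = ~-irrefl
    }

  Dominating : Subset n → Set
  Dominating S = ∀ v → v ∉ S → ∃[ u ] u ∈ S × v ~ u

  IsPDSet : Subset n → Set₁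
  IsPDSet S = Dominating S × SimpleGraph.PerfectMatching (induced S)

  -- `IsPairedDominationNumber k` states γpr(G) = k.
  IsPairedDominationNumber : ℕ → Set₁
  IsPairedDominationNumber = IsMinimum (λ k → ∃[ S ] IsPDSet S × ∣ S ∣ ≡ k)

  IsγprSet : Subset n → Set₁
  IsγprSet S = IsPDSet S × IsPairedDominationNumber ∣ S ∣

-- Vertices 1,…,n are the elements of Fin n (so vertex 1 is `zero`), whereas
-- array positions 0,…,n are the elements of Fin (suc n): the dummy 0 is
-- `zero`, and the vertex v sits at position `suc v`.

LevelOrdered : ∀ {n} → SimpleGraph (Fin (suc n)) → Set
LevelOrdered T = ∀ {i j a b} → i < j →
  IsDistance zero i a → IsDistance zero j b → a ≤ b
  where open SimpleGraph T

-- The entries parent[1],…,parent[n].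
ParentArray : ℕ → Set
ParentArray n = Vec (Fin (suc n)) n

IsParentArray : ∀ {n} → SimpleGraph (Fin (suc n)) → ParentArray (suc n) → Set
IsParentArray T parent =
  lookup parent zero ≡ zero ×
  (∀ i → i ≢ zero → ∃[ p ] lookup parent i ≡ suc p × IsParent zero i p)
  where open SimpleGraph T

module TreePairedDomination {m : ℕ} (parentArray : ParentArray (suc (suc m))) where

  n : ℕ
  n = suc (suc m)

  Pos : Set
  Pos = Fin (suc n)

  1ᵖ 2ᵖ : Pos
  1ᵖ = suc zero
  2ᵖ = suc (suc zero)

  -- Extended by parent[0] = 0.
  parent : Pos → Pos
  parent = lookup (zero ∷ parentArray)

  record State : Set where
    constructor ⟨_,_⟩
    field
      InPD       : Vec Bool (suc n)
      DomByChild : Vec Bool (suc n)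

  initial : State
  initial = ⟨ replicate (suc n) false , replicate (suc n) false ⟩

  -- The child of p of largest label that is not yet in the set.
  largestFreeChild : Vec Bool (suc n) → Pos → Maybe Pos
  largestFreeChild inPD p =
    last (filter (λ j → (parent j ≟ p) ×-dec (lookup inPD j Bool.≟ false))
                 (tabulate {n = n} suc))

  stepA : Pos → State → State
  stepA i s@(⟨ inPD , dom ⟩) =
    if not (lookup dom i) ∧ not (lookup inPD p) ∧ not ⌊ p ≟ 1ᵖ ⌋ ∧ not (lookup inPD g)
    then ⟨ inPD [ p ]≔ true [ g ]≔ true
         , dom [ g ]≔ true [ parent g ]≔ true ⟩
    else s
    where
    p = parent i
    g = parent p

  -- In a run of the algorithm, i itself is a free child of p whenever the
  -- condition of this step holds, so the `nothing` case does not occur.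
  stepB : Pos → State → State
  stepB i s@(⟨ inPD , dom ⟩) =
    if not (lookup dom i) ∧ not (lookup inPD p) ∧ (⌊ p ≟ 1ᵖ ⌋ ∨ lookup inPD g)
    then addPair (largestFreeChild inPD p)
    else s
    where
    p = parent i
    g = parent p

    addPair : Maybe Pos → State
    addPair (just i₁) = ⟨ inPD [ p ]≔ true [ i₁ ]≔ true , dom [ p ]≔ true ⟩
    addPair nothing   = s

  -- foldr treats the last position of the list 2,…,n first, so i runs
  -- through n,…,2.
  loop : State
  loop = foldr (λ i s → stepB i (stepA i s)) initial
               (tabulate {n = suc m} (λ k → suc (suc k)))

  finish : State → State
  finish s@(⟨ inPD , dom ⟩) =
    if not (lookup dom 1ᵖ)
    then ⟨ inPD [ 1ᵖ ]≔ true [ 2ᵖ ]≔ true , dom [ 1ᵖ ]≔ true ⟩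
    else s

  -- The dummy position is dropped.
  output : Subset n
  output = tail (State.InPD (finish loop))

open TreePairedDomination public using () renaming (output to treePairedDomination)

module Submission where

-- Call a vertex i a witness if the algorithm adds a pair when it comes to i.
-- At that moment i is neither dominated by a child nor is its parent in the
-- set, and every vertex of depth at most depth w within distance 3 of an
-- earlier witness w is already dominated in this sense.  Hence the witnesses
-- are pairwise at distance more than 3, so the matched pairs through which a
-- paired dominating set dominates them are disjoint, and it has at least two
-- vertices per witness; the algorithm uses at most two.

open import Defs
open import Data.Bool.Base using (Bool; true; false; not; _∧_; _∨_)
import Data.Bool.Properties as Bool
open import Data.Bool.Properties using (¬-not; ∧-zeroʳ)
open import Data.Empty using (⊥; ⊥-elim)
open import Data.Fin.Base using (Fin; zero; suc; toℕ; _<_)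
open import Data.Fin.Properties using (_≟_; toℕ-injective; suc-injective; toℕ<n)
open import Data.Fin.Subset using (Subset; _∈_; ∣_∣; _-_)
open import Data.Fin.Subset.Properties using (_∈?_; x∈p∧x≢y⇒x∈p-y; x∈p⇒∣p-x∣<∣p∣)
open import Data.List.Base using (List; []; _∷_; foldr; tabulate; last)
import Data.List.Base as List
open import Data.List.Membership.Propositional using () renaming (_∈_ to _∈ₗ_; _∉_ to _∉ₗ_)
import Data.List.Membership.DecPropositional as DecMembership
open import Data.List.Membership.Propositional.Properties using (∈-filter⁺; ∈-filter⁻; ∈-tabulate⁺)
open import Data.List.Relation.Binary.Subset.Propositional using (_⊆_)
open import Data.List.Relation.Unary.All as All using (All; []; _∷_)
open import Data.List.Relation.Unary.All.Properties using (¬Any⇒All¬; All¬⇒¬Any)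
open import Data.List.Relation.Unary.AllPairs using (AllPairs; []; _∷_)
open import Data.List.Relation.Unary.Any using (here; there)
open import Data.Maybe.Base using (just)
open import Data.Nat.Base using (ℕ; zero; suc; z≤n; s≤s; _≤_; _+_; _*_)
open import Data.Nat.Properties
  using (≤-refl; ≤-trans; ≤-reflexive; n≤1+n; m≤n⇒m≤1+n; <⇒≤; <-irrefl; 1+n≰n; ≤-pred; +-suc; *-suc;
         module ≤-Reasoning; +-cancelʳ-≤; +-monoʳ-≤; +-identityʳ; +-comm; m≤n⇒m<n∨m≡n)
open import Data.Product.Base using (Σ; ∃-syntax; _×_; _,_; proj₁; proj₂)
open import Data.Sum.Base using (_⊎_; inj₁; inj₂; [_,_]′)
import Data.Sum.Base as Sum
open import Data.Vec.Base using (Vec; _∷_; lookup; replicate; tail; _[_]≔_)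
open import Data.Vec.Properties using (lookup∘update; lookup∘update′; lookup-replicate; []=⇒lookup; lookup⇒[]=)
open import Data.Vec.Properties.WithK using ([]=-irrelevant)
open import Function.Base using (_∘_; id; case_of_)
open import Relation.Binary.Construct.Closure.ReflexiveTransitive using (Star; ε; _◅_; _◅◅_; reverse)
open import Relation.Binary.Definitions using (DecidableEquality)
open import Relation.Binary.PropositionalEquality using (_≡_; _≢_; refl; sym; trans; cong; subst; ≢-sym)
open import Relation.Nullary using (¬_; yes; no)
open import Relation.Nullary.Decidable using (⌊_⌋; _×-dec_)

-- Walks and parents in acyclic graphs.

module Acyclicity {V : Set} (_≟ᵥ_ : DecidableEquality V) (G : SimpleGraph V) where
  open SimpleGraph G
  open DecMembership _≟ᵥ_ using () renaming (_∈?_ to _∈ₗ?_)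

  -- Avoidance is recorded edge by edge and at both ends, so that such walks can be concatenated and
  -- reversed. The empty walk records nothing, which is why `loopErase` asks separately that its
  -- start differ from `x`.
  AvoidingEdge : V → V → V → Set
  AvoidingEdge x a b = a ~ b × a ≢ x × b ≢ x

  AvoidingWalk : V → V → V → Set
  AvoidingWalk x = Star (AvoidingEdge x)

  AvoidingEdge-sym : ∀ {x a b} → AvoidingEdge x a b → AvoidingEdge x b a
  AvoidingEdge-sym (a~b , a≢x , b≢x) = ~-sym a~b , b≢x , a≢x

  end∈vertices : ∀ {a b} (w : Walk a b) → b ∈ₗ vertices w
  end∈vertices ε       = here refl
  end∈vertices (_ ◅ w) = there (end∈vertices w)

  pathSuffix : ∀ {a b c} (w : Walk a b) → IsPath w → c ∈ₗ vertices w →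
    Σ (Walk c b) λ w′ → IsPath w′ × vertices w′ ⊆ vertices w
  pathSuffix ε       path       (here refl) = ε , path , id
  pathSuffix (e ◅ w) path       (here refl) = e ◅ w , path , id
  pathSuffix (e ◅ w) (_ ∷ path) (there c∈w) =
    let w′ , path′ , w′⊆w = pathSuffix w path c∈w in w′ , path′ , there ∘ w′⊆w

  walkPrefix : ∀ {x a b c} (w : Walk a b) → x ∉ₗ vertices w → c ∈ₗ vertices w → AvoidingWalk x a c
  walkPrefix ε       x∉ (here refl) = ε
  walkPrefix (e ◅ w) x∉ (here refl) = ε
  walkPrefix (e ◅ w) x∉ (there c∈w) =
    (e , (λ { refl → x∉ (here refl) }) , λ { refl → x∉ (there (start∈ w)) }) ◅ walkPrefix w (x∉ ∘ there) c∈w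
    where
    start∈ : ∀ {a b} (w : Walk a b) → a ∈ₗ vertices w
    start∈ ε       = here refl
    start∈ (_ ◅ _) = here refl

  loopErase : ∀ {x a b} → AvoidingWalk x a b → a ≢ x →
    Σ (Walk a b) λ w → IsPath w × x ∉ₗ vertices w
  loopErase ε a≢x = ε , [] ∷ [] , λ { (here x≡a) → a≢x (sym x≡a) }
  loopErase {a = a} ((a~c , _ , c≢x) ◅ w) a≢x with loopErase w c≢x
  ... | w′ , path , x∉w′ with a ∈ₗ? vertices w′
  ...   | yes a∈w′ = let w″ , path″ , w″⊆w′ = pathSuffix w′ path a∈w′ in w″ , path″ , x∉w′ ∘ w″⊆w′
  ...   | no  a∉w′ = a~c ◅ w′ , ¬Any⇒All¬ _ a∉w′ ∷ path ,
                     λ { (here x≡a) → a≢x (sym x≡a) ; (there x∈w′) → x∉w′ x∈w′ }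

  ~⇒≢ : ∀ {a b} → a ~ b → a ≢ b
  ~⇒≢ a~b refl = ~-irrefl a~b

  -- After loop erasure, a nonempty path from `a` to `b` avoiding `x`, prefixed with the edge from
  -- `x` to `a`, is closed into a cycle by the edge from `b` to `x`.
  neighbours-separated : Acyclic → ∀ {x a b} → x ~ a → x ~ b → AvoidingWalk x a b → a ≡ b
  neighbours-separated acyclic x~a x~b w with loopErase w (≢-sym (~⇒≢ x~a))
  ... | ε             , _    , _    = refl
  ... | w′@(_ ◅ _) , path , x∉w′ =
    ⊥-elim (acyclic (x~a ◅ w′) (¬Any⇒All¬ _ x∉w′ ∷ path) (s≤s (s≤s z≤n)) (~-sym x~b))

  -- `IsParent` allows `p` anywhere on the path. The successor of `i` on the path is also a
  -- neighbour of `i`, and the stretch of path between it and `p` avoids `i`, so the two coincide.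
  parent-first : Acyclic → ∀ {r i p} → i ≢ r → IsParent r i p →
    Σ (Walk p r) λ w → i ∉ₗ vertices w
  parent-first acyclic i≢r (_ , ε , _) = ⊥-elim (i≢r refl)
  parent-first acyclic i≢r (i~p , _ ◅ _ , _ , here refl) = ⊥-elim (~-irrefl i~p)
  parent-first acyclic i≢r (i~p , i~q ◅ w , i∉w ∷ _ , there p∈w)
    with neighbours-separated acyclic i~q i~p (walkPrefix w (All¬⇒¬Any i∉w) p∈w)
  ... | refl = w , All¬⇒¬Any i∉w

  -- If `v` lies on the path from `p` to the root, then `p` and `v` are neighbours of `u` joined by
  -- a walk avoiding `u`. Otherwise the walk from `q` up to the root and back down to `u` avoids
  -- `v`, and both its ends are neighbours of `v`.
  edge-to-parent : Acyclic → ∀ {r u v p q} → u ≢ r → v ≢ r → IsParent r u p → IsParent r v q →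
    u ~ v → p ≡ v ⊎ q ≡ u
  edge-to-parent acyclic {u = u} {v} u≢r v≢r up vq u~v
    with parent-first acyclic u≢r up | parent-first acyclic v≢r vq
  ... | wᵤ , u∉wᵤ | wᵥ , v∉wᵥ with v ∈ₗ? vertices wᵤ
  ...   | yes v∈wᵤ = inj₁ (neighbours-separated acyclic (proj₁ up) u~v (walkPrefix wᵤ u∉wᵤ v∈wᵤ))
  ...   | no  v∉wᵤ = inj₂ (neighbours-separated acyclic (proj₁ vq) (~-sym u~v)
            (walkPrefix wᵥ v∉wᵥ (end∈vertices wᵥ) ◅◅
             reverse AvoidingEdge-sym (walkPrefix (u~v′ ◅ wᵤ) v∉uwᵤ (end∈vertices (u~v′ ◅ wᵤ)))))
    where
    u~v′ = proj₁ up
    v∉uwᵤ : v ∉ₗ u ∷ vertices wᵤ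
    v∉uwᵤ (here refl)  = ~-irrefl u~v
    v∉uwᵤ (there v∈wᵤ) = v∉wᵤ v∈wᵤ

  edge-to-root : Acyclic → ∀ {r u p} → IsParent r u p → u ~ r → p ≡ r
  edge-to-root acyclic up u~r with parent-first acyclic (~⇒≢ u~r) up
  ... | w , u∉w = neighbours-separated acyclic (proj₁ up) u~r (walkPrefix w u∉w (end∈vertices w))

-- Packings as lower bounds for paired domination.

subset-≡ : ∀ {k} {S : Subset k} {x y : ∃[ v ] v ∈ S} → proj₁ x ≡ proj₁ y → x ≡ y
subset-≡ {x = v , p} {y = .v , q} refl = cong (v ,_) ([]=-irrelevant p q)

module Packing {n : ℕ} (G : SimpleGraph (Fin n)) where
  open SimpleGraph G

  _≃_ : Fin n → Fin n → Set
  u ≃ v = u ≡ v ⊎ u ~ v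

  Within3 : Fin n → Fin n → Set
  Within3 u v = ∃[ a ] ∃[ b ] u ≃ a × a ≃ b × b ≃ v

  ≃-sym : ∀ {u v} → u ≃ v → v ≃ u
  ≃-sym = Sum.map sym ~-sym

  -- The matched pair through which a PD-set dominates v determines v among
  -- the members of a 3-packing.
  packing-bound : ∀ {S} → IsPDSet G S → ∀ W → AllPairs (λ u v → ¬ Within3 u v) W → 2 * List.length W ≤ ∣ S ∣
  packing-bound {S} (dominating , matching) W far =
    bound W far S (All.universal (λ w → proj₂ (dominator w)) W) (All.universal (λ w → proj₂ (partner w)) W)
    where
    open SimpleGraph.PerfectMatching matching

    dominator : Fin n → ∃[ v ] v ∈ S
    dominator w with w ∈? S
    ... | yes w∈S = w , w∈S
    ... | no  w∉S = let u , u∈S , _ = dominating w w∉S in u , u∈S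

    dominates : ∀ w → w ≃ proj₁ (dominator w)
    dominates w with w ∈? S
    ... | yes w∈S = inj₁ refl
    ... | no  w∉S = inj₂ (proj₂ (proj₂ (dominating w w∉S)))

    partner : Fin n → ∃[ v ] v ∈ S
    partner w = proj₁ (perfect (dominator w))

    matched : ∀ w → M (dominator w) (partner w)
    matched w = proj₁ (proj₂ (perfect (dominator w)))

    dom′ par′ : Fin n → Fin n
    dom′ = proj₁ ∘ dominator
    par′ = proj₁ ∘ partner

    dominator~partner : ∀ w → dom′ w ~ par′ w
    dominator~partner = M⊆~ ∘ matched

    -- A vertex shared by the pairs of `u` and `v` gives a route of three steps: from `u` to its
    -- dominator, along at most one matching edge, and back to `v`.
    dom≡dom : ∀ {u v} → dom′ u ≡ dom′ v → Within3 u v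
    dom≡dom {u} {v} eq = dom′ u , dom′ v , dominates u , inj₁ eq , ≃-sym (dominates v)

    dom≡par : ∀ {u v} → dom′ u ≡ par′ v → Within3 u v
    dom≡par {u} {v} eq =
      dom′ u , dom′ v , dominates u , inj₂ (subst (_~ dom′ v) (sym eq) (~-sym (dominator~partner v))) , ≃-sym (dominates v)

    par≡dom : ∀ {u v} → par′ u ≡ dom′ v → Within3 u v
    par≡dom {u} {v} eq =
      dom′ u , dom′ v , dominates u , inj₂ (subst (dom′ u ~_) eq (dominator~partner u)) , ≃-sym (dominates v)

    -- Equal partners have the same unique partner, so the dominators are already equal and no
    -- second matching edge is spent.
    par≡par : ∀ {u v} → par′ u ≡ par′ v → Within3 u v
    par≡par {u} {v} eq = dom≡dom (cong proj₁ (trans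
      (sym (proj₂ (proj₂ (perfect (partner u))) (M-sym (matched u))))
      (proj₂ (proj₂ (perfect (partner u))) (subst (λ x → M x (dominator v)) (sym (subset-≡ eq)) (M-sym (matched v))))))

    -- `S` is generalised to any set `p` containing all the pairs, so that the two vertices of the
    -- first pair can be deleted before the induction continues.
    bound : ∀ W → AllPairs (λ u v → ¬ Within3 u v) W → ∀ p →
      All (λ w → dom′ w ∈ p) W → All (λ w → par′ w ∈ p) W → 2 * List.length W ≤ ∣ p ∣
    bound [] _ p _ _ = z≤n
    bound (w ∷ W) (w-far ∷ far) p (d ∷ ds) (m ∷ ms) = begin
      2 * suc (List.length W)           ≡⟨ *-suc 2 (List.length W) ⟩
      2 + 2 * List.length W             ≤⟨ s≤s (s≤s (bound W far (p - dom′ w - par′ w) ds′ ms′)) ⟩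
      2 + ∣ p - dom′ w - par′ w ∣       ≤⟨ s≤s (x∈p⇒∣p-x∣<∣p∣ (x∈p∧x≢y⇒x∈p-y m (≢-sym w≢))) ⟩
      suc ∣ p - dom′ w ∣                ≤⟨ x∈p⇒∣p-x∣<∣p∣ d ⟩
      ∣ p ∣                             ∎
      where
      open ≤-Reasoning
      w≢ : dom′ w ≢ par′ w
      w≢ eq = ~-irrefl (subst (_~ par′ w) eq (dominator~partner w))
      ds′ : All (λ v → dom′ v ∈ p - dom′ w - par′ w) W
      ds′ = All.zipWith (λ (d , f) → x∈p∧x≢y⇒x∈p-y (x∈p∧x≢y⇒x∈p-y d (f ∘ dom≡dom ∘ sym)) (f ∘ par≡dom ∘ sym)) (ds , w-far)
      ms′ : All (λ v → par′ v ∈ p - dom′ w - par′ w) W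
      ms′ = All.zipWith (λ (d , f) → x∈p∧x≢y⇒x∈p-y (x∈p∧x≢y⇒x∈p-y d (f ∘ dom≡par ∘ sym)) (f ∘ par≡par ∘ sym)) (ms , w-far)

-- Depths, parents and common ancestors in the rooted tree.

module RootedTree {m : ℕ} (T : SimpleGraph (Fin (suc (suc m)))) (parentArray : ParentArray (suc (suc m)))
  (tree : SimpleGraph.IsTree T) (ordered : LevelOrdered T) (isParentArray : IsParentArray T parentArray) where
  open SimpleGraph T
  open TreePairedDomination parentArray using (n; Pos; 1ᵖ; 2ᵖ; parent)
  open Acyclicity _≟_ T using (edge-to-parent; edge-to-root)
  open Packing T using (_≃_; Within3)

  0ᵖ : Pos
  0ᵖ = zero

  parent-1 : parent 1ᵖ ≡ 0ᵖ
  parent-1 = proj₁ isParentArray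

  parent-suc : ∀ {v} → v ≢ zero → ∃[ p ] parent (suc v) ≡ suc p × IsParent zero v p
  parent-suc = proj₂ isParentArray _

  ~⇒parent : ∀ {u v} → u ~ v → parent (suc u) ≡ suc v ⊎ parent (suc v) ≡ suc u
  ~⇒parent {u} {v} u~v with u ≟ zero | v ≟ zero
  ... | yes refl | yes refl = ⊥-elim (~-irrefl u~v)
  ... | yes refl | no v≢0 = let q , eq , vq = parent-suc v≢0 in
    inj₂ (trans eq (cong suc (edge-to-root (proj₂ tree) vq (~-sym u~v))))
  ... | no u≢0 | yes refl = let p , eq , up = parent-suc u≢0 in
    inj₁ (trans eq (cong suc (edge-to-root (proj₂ tree) up u~v)))
  ... | no u≢0 | no v≢0 = let p , eq , up = parent-suc u≢0 ; q , eq′ , vq = parent-suc v≢0 in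
    Sum.map (trans eq ∘ cong suc) (trans eq′ ∘ cong suc) (edge-to-parent (proj₂ tree) u≢0 v≢0 up vq u~v)

  parent⇒~ : ∀ {u v} → parent (suc u) ≡ suc v → u ~ v
  parent⇒~ {u} eq with u ≟ zero
  ... | yes refl = case trans (sym parent-1) eq of λ ()
  ... | no u≢0 with parent-suc u≢0
  ...   | p , eq′ , u~p , _ with trans (sym eq′) eq
  ...     | refl = u~p

  -- The dummy has depth 0 and the root depth 1, so that the depth of every
  -- vertex, root included, is one more than that of its parent.
  data Depth : Pos → ℕ → Set where
    dummy  : Depth 0ᵖ 0
    vertex : ∀ {v k} → Depth (parent (suc v)) k → Depth (suc v) (suc k)

  Depth-unique : ∀ {x j k} → Depth x j → Depth x k → j ≡ k
  Depth-unique dummy      dummy      = refl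
  Depth-unique (vertex d) (vertex e) = cong suc (Depth-unique d e)

  Depth-root : Depth 1ᵖ 1
  Depth-root = vertex (subst (λ x → Depth x 0) (sym parent-1) dummy)

  Depth-edge : ∀ {u v k} → u ~ v → Depth (suc u) k → ∃[ j ] j ≤ suc k × Depth (suc v) j
  Depth-edge u~v d with ~⇒parent u~v
  Depth-edge u~v (vertex d) | inj₁ eq = _ , m≤n⇒m≤1+n (n≤1+n _) , subst (λ x → Depth x _) eq d
  Depth-edge u~v d          | inj₂ eq = _ , ≤-refl , vertex (subst (λ x → Depth x _) (sym eq) d)

  Depth-walk : ∀ {u v k} (w : Walk u v) → Depth (suc u) k → ∃[ j ] j ≤ length w + k × Depth (suc v) j
  Depth-walk ε       d = _ , ≤-refl , d
  Depth-walk (e ◅ w) d =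
    let i , i≤ , d′ = Depth-edge e d
        j , j≤ , d″ = Depth-walk w d′
    in j , ≤-trans j≤ (≤-trans (+-monoʳ-≤ (length w) i≤) (≤-reflexive (+-suc (length w) _))) , d″

  -- Recursion along `parent` is not structural, so a depth is transported from the root along a
  -- walk supplied by connectedness.
  ∃Depth : ∀ x → ∃[ k ] Depth x k
  ∃Depth zero    = 0 , dummy
  ∃Depth (suc v) = let k , _ , d = Depth-walk (proj₁ tree zero v) Depth-root in k , d

  depth : Pos → ℕ
  depth = proj₁ ∘ ∃Depth

  depth-suc : ∀ v → depth (suc v) ≡ suc (depth (parent (suc v)))
  depth-suc v = Depth-unique (proj₂ (∃Depth (suc v))) (vertex (proj₂ (∃Depth _)))

  -- `w` is an accumulator: each climb to a parent prepends the reversed edge.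
  walkFromRoot : ∀ k {v z} → Depth (suc v) (suc k) → (w : Walk v z) →
    Σ (Walk zero z) λ w′ → length w′ ≡ k + length w
  walkFromRoot k {v} d w with v ≟ zero
  walkFromRoot k d w | yes refl with Depth-unique d Depth-root
  ... | refl = w , refl
  walkFromRoot k (vertex d) w | no v≢0 with parent-suc v≢0
  ... | p , eq , v~p , _ with k | subst (λ x → Depth x k) eq d
  ...   | suc k | d′ = let w′ , len = walkFromRoot k d′ (~-sym v~p ◅ w) in w′ , trans len (+-suc k (length w))

  -- Depths start at 1 at the root, so the distance is the depth of the parent. Climbing gives a
  -- walk of that length; none is shorter, because an edge raises the depth by at most one.
  IsDistance-depth : ∀ v → IsDistance zero v (depth (parent (suc v)))
  IsDistance-depth v =
    (let w , len = walkFromRoot _ (vertex (proj₂ (∃Depth _))) ε in w , trans len (+-identityʳ _)) ,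
    λ { (w , refl) → let j , j≤ , d = Depth-walk w Depth-root in
      ≤-pred (subst (_≤ suc (length w)) (Depth-unique d (vertex (proj₂ (∃Depth _))))
        (≤-trans j≤ (≤-reflexive (+-comm (length w) 1)))) }

  depth-mono : ∀ {x y : Pos} → x < y → depth x ≤ depth y
  depth-mono {zero}  {y}     _         = z≤n
  depth-mono {suc u} {suc v} (s≤s u<v) rewrite depth-suc u | depth-suc v =
    s≤s (ordered u<v (IsDistance-depth u) (IsDistance-depth v))

  depth-parent : ∀ {x} → x ≢ 0ᵖ → depth x ≡ suc (depth (parent x))
  depth-parent {zero}  x≢0 = ⊥-elim (x≢0 refl)
  depth-parent {suc v} _   = depth-suc v

  parent≡0⇒root : ∀ {v} → parent (suc v) ≡ 0ᵖ → v ≡ zero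
  parent≡0⇒root {v} eq with v ≟ zero
  ... | yes v≡0 = v≡0
  ... | no  v≢0 with parent-suc v≢0
  ...   | p , eq′ , _ = case trans (sym eq) eq′ of λ ()

  -- A parent with a label above 2 would, by the level order, be at least as deep as its child.
  parent-2 : parent 2ᵖ ≡ 1ᵖ
  parent-2 with parent-suc {v = suc zero} (λ ())
  ... | zero  , eq , _ = eq
  ... | suc zero    , eq , _ = ⊥-elim (~-irrefl (parent⇒~ eq))
  ... | suc (suc p) , eq , _ =
    ⊥-elim (1+n≰n (subst (_≤ depth (suc (suc (suc p)))) (trans (depth-suc (suc zero)) (cong (suc ∘ depth) eq)) (depth-mono 2<p)))
    where
    2<p : 2ᵖ < suc (suc (suc p))
    2<p = s≤s (s≤s (s≤s z≤n))

  ancestor : ℕ → Pos → Pos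
  ancestor zero    x = x
  ancestor (suc k) x = ancestor k (parent x)

  ancestor-parent : ∀ k x → ancestor k (parent x) ≡ parent (ancestor k x)
  ancestor-parent zero    x = refl
  ancestor-parent (suc k) x = ancestor-parent k (parent x)

  ancestor-dummy : ∀ k → ancestor k 0ᵖ ≡ 0ᵖ
  ancestor-dummy zero    = refl
  ancestor-dummy (suc k) = ancestor-dummy k

  depth-ancestor : ∀ k x → ancestor k x ≢ 0ᵖ → depth x ≡ k + depth (ancestor k x)
  depth-ancestor zero    x _  = refl
  depth-ancestor (suc k) x ≢0 =
    trans (depth-parent {x} (λ { refl → ≢0 (ancestor-dummy k) })) (cong suc (depth-ancestor k (parent x) ≢0))

  -- The dummy is excluded because every chain of parents ends there.
  CommonAncestor : ℕ → ℕ → Fin n → Fin n → Set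
  CommonAncestor a b u v = ancestor a (suc u) ≡ ancestor b (suc v) × ancestor b (suc v) ≢ 0ᵖ

  -- A step down to a child lengthens the chain from `v`. A step up shortens it, unless `v` is
  -- itself the common ancestor; then the meeting point moves up and the chain from `u` grows
  -- instead.
  CommonAncestor-step : ∀ {a b u v w k} → CommonAncestor a b u v → v ≃ w → a + b ≤ k →
    ∃[ a′ ] ∃[ b′ ] CommonAncestor a′ b′ u w × a′ + b′ ≤ suc k
  CommonAncestor-step {a} {b} ca (inj₁ refl) a+b≤k = a , b , ca , m≤n⇒m≤1+n a+b≤k
  CommonAncestor-step {a} {b} (eq , ≢0) (inj₂ v~w) a+b≤k with ~⇒parent v~w
  CommonAncestor-step {a} {b} (eq , ≢0) (inj₂ v~w) a+b≤k | inj₂ pw =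
    a , suc b , (trans eq (cong (ancestor b) (sym pw)) , λ eq₀ → ≢0 (trans (cong (ancestor b) (sym pw)) eq₀)) ,
    ≤-trans (≤-reflexive (+-suc a b)) (s≤s a+b≤k)
  CommonAncestor-step {a} {zero} (eq , ≢0) (inj₂ v~w) a+b≤k | inj₁ pv =
    suc a , 0 , (trans (ancestor-parent a _) (trans (cong parent eq) pv) , λ ()) , s≤s a+b≤k
  CommonAncestor-step {a} {suc b} (eq , ≢0) (inj₂ v~w) a+b≤k | inj₁ pv =
    a , b , (trans eq (cong (ancestor b) pv) , λ eq₀ → ≢0 (trans (cong (ancestor b) pv) eq₀)) ,
    ≤-trans (≤-trans (n≤1+n _) (≤-reflexive (sym (+-suc a b)))) (m≤n⇒m≤1+n a+b≤k)

  Within3⇒CommonAncestor : ∀ {u v} → Within3 u v → ∃[ a ] ∃[ b ] CommonAncestor a b u v × a + b ≤ 3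
  Within3⇒CommonAncestor {u} (_ , _ , ux , xy , yv) =
    let a₁ , b₁ , c₁ , l₁ = CommonAncestor-step {0} {0} {u} (refl , λ ()) ux z≤n
        a₂ , b₂ , c₂ , l₂ = CommonAncestor-step {a₁} {b₁} c₁ xy l₁
    in CommonAncestor-step {a₂} {b₂} c₂ yv l₂

  CommonAncestor-depth : ∀ {a b u v} → CommonAncestor a b u v → depth (suc u) ≤ depth (suc v) → a ≤ b
  CommonAncestor-depth {a} {b} {u} {v} (eq , ≢0) u≤v =
    +-cancelʳ-≤ (depth (ancestor b (suc v))) a b (≤-trans (≤-reflexive (sym u≡)) (≤-trans u≤v
      (≤-reflexive (depth-ancestor b (suc v) ≢0))))
    where
    u≡ : depth (suc u) ≡ a + depth (ancestor b (suc v))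
    u≡ = trans (depth-ancestor a (suc u) (λ e → ≢0 (trans (sym eq) e))) (cong (λ x → a + depth x) eq)

  -- Adjacency on array positions. The dummy is adjacent to nothing, so a position that has a mate
  -- is a genuine vertex.
  Adjacent : Pos → Pos → Set
  Adjacent (suc u) (suc v) = u ~ v
  Adjacent _       _       = ⊥

  Adjacent-sym : ∀ {x y} → Adjacent x y → Adjacent y x
  Adjacent-sym {suc _} {suc _} = ~-sym

  Adjacent⇒≢ : ∀ {x y} → Adjacent x y → x ≢ y
  Adjacent⇒≢ {suc _} u~v refl = ~-irrefl u~v

  Adjacent⇒≢0 : ∀ {x y} → Adjacent x y → x ≢ 0ᵖ
  Adjacent⇒≢0 {suc _} _ ()

  Adjacent-parent : ∀ {x y} → parent x ≡ y → x ≢ 0ᵖ → y ≢ 0ᵖ → Adjacent x y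
  Adjacent-parent {zero}          _  x≢0 _   = ⊥-elim (x≢0 refl)
  Adjacent-parent {suc _} {zero}  _  _   y≢0 = ⊥-elim (y≢0 refl)
  Adjacent-parent {suc _} {suc _} eq _   _   = parent⇒~ eq

  parent≢0 : ∀ {x} → x ≢ 0ᵖ → x ≢ 1ᵖ → parent x ≢ 0ᵖ
  parent≢0 {zero}  x≢0 _   _  = x≢0 refl
  parent≢0 {suc v} _   x≢1 eq = x≢1 (cong suc (parent≡0⇒root eq))

-- Boolean arrays, lists, folds and extension of a matching.

module _ {k : ℕ} (v : Vec Bool k) where

  set-true-∋ : ∀ a → lookup (v [ a ]≔ true) a ≡ true
  set-true-∋ a = lookup∘update a v true

  set-true-⊇ : ∀ a {x} → lookup v x ≡ true → lookup (v [ a ]≔ true) x ≡ true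
  set-true-⊇ a {x} x∈v with x ≟ a
  ... | yes refl = set-true-∋ a
  ... | no  x≢a  = trans (lookup∘update′ x≢a v true) x∈v

  set-true⁻ : ∀ a {x} → lookup (v [ a ]≔ true) x ≡ true → x ≡ a ⊎ lookup v x ≡ true
  set-true⁻ a {x} x∈ with x ≟ a
  ... | yes x≡a = inj₁ x≡a
  ... | no  x≢a = inj₂ (trans (sym (lookup∘update′ x≢a v true)) x∈)

module _ {k : ℕ} (v : Vec Bool k) (a b : Fin k) where

  set-pair-∋ˡ : lookup (v [ a ]≔ true [ b ]≔ true) a ≡ true
  set-pair-∋ˡ = set-true-⊇ (v [ a ]≔ true) b (set-true-∋ v a)

  set-pair-∋ʳ : lookup (v [ a ]≔ true [ b ]≔ true) b ≡ true
  set-pair-∋ʳ = set-true-∋ (v [ a ]≔ true) b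

  set-pair-⊇ : ∀ {x} → lookup v x ≡ true → lookup (v [ a ]≔ true [ b ]≔ true) x ≡ true
  set-pair-⊇ = set-true-⊇ (v [ a ]≔ true) b ∘ set-true-⊇ v a

  set-pair⁻ : ∀ {x} → lookup (v [ a ]≔ true [ b ]≔ true) x ≡ true → x ≡ a ⊎ x ≡ b ⊎ lookup v x ≡ true
  set-pair⁻ x∈ = [ inj₂ ∘ inj₁ , Sum.map id inj₂ ∘ set-true⁻ v a ]′ (set-true⁻ (v [ a ]≔ true) b x∈)

∣set-true∣ : ∀ {k} (p : Subset k) a → ∣ p [ a ]≔ true ∣ ≤ suc ∣ p ∣
∣set-true∣ (true  ∷ p) zero    = n≤1+n _
∣set-true∣ (false ∷ p) zero    = ≤-refl
∣set-true∣ (true  ∷ p) (suc a) = s≤s (∣set-true∣ p a)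
∣set-true∣ (false ∷ p) (suc a) = ∣set-true∣ p a

∣tail∣ : ∀ {k} (p : Subset (suc k)) → ∣ tail p ∣ ≤ ∣ p ∣
∣tail∣ (true  ∷ p) = n≤1+n _
∣tail∣ (false ∷ p) = ≤-refl

∣replicate-false∣ : ∀ k → ∣ replicate k false ∣ ≡ 0
∣replicate-false∣ zero    = refl
∣replicate-false∣ (suc k) = ∣replicate-false∣ k

last-∈ : ∀ {A : Set} {x : A} {xs} → x ∈ₗ xs → ∃[ y ] last xs ≡ just y × y ∈ₗ xs
last-∈ {xs = y ∷ []}     _ = y , refl , here refl
last-∈ {xs = _ ∷ z ∷ zs} _ = let y , eq , y∈ = last-∈ {xs = z ∷ zs} (here refl) in y , eq , there y∈

-- The index of `Q` is the start of the suffix folded so far; it falls from `k` to 0, as `foldr`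
-- treats the last entry first.
foldr-tabulate-induct : ∀ {A B : Set} {k} (Q : ℕ → B → Set) (g : A → B → B) {b} (f : Fin k → A) →
  Q k b → (∀ j {s} → Q (suc (toℕ j)) s → Q (toℕ j) (g (f j) s)) → Q 0 (foldr g b (tabulate f))
foldr-tabulate-induct {k = zero}  Q g f base step = base
foldr-tabulate-induct {k = suc k} Q g f base step =
  step zero (foldr-tabulate-induct (Q ∘ suc) g (f ∘ suc) base (step ∘ suc))

module Rematch {k : ℕ} (a b : Fin k) (μ : Fin k → Fin k) where

  rematch : Fin k → Fin k
  rematch x with x ≟ a | x ≟ b
  ... | yes _ | _     = b
  ... | no _  | yes _ = a
  ... | no _  | no _  = μ x

  rematch-a : rematch a ≡ b
  rematch-a with a ≟ a | a ≟ b
  ... | yes _  | _ = refl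
  ... | no a≢a | _ = ⊥-elim (a≢a refl)

  rematch-b : a ≢ b → rematch b ≡ a
  rematch-b a≢b with b ≟ a | b ≟ b
  ... | yes b≡a | _      = ⊥-elim (a≢b (sym b≡a))
  ... | no _    | yes _  = refl
  ... | no _    | no b≢b = ⊥-elim (b≢b refl)

  rematch-other : ∀ {x} → x ≢ a → x ≢ b → rematch x ≡ μ x
  rematch-other {x} x≢a x≢b with x ≟ a | x ≟ b
  ... | yes x≡a | _       = ⊥-elim (x≢a x≡a)
  ... | no _    | yes x≡b = ⊥-elim (x≢b x≡b)
  ... | no _    | no _    = refl

-- The invariant of the algorithm and its preservation when a pair is added.

module Correctness {m : ℕ} (T : SimpleGraph (Fin (suc (suc m)))) (parentArray : ParentArray (suc (suc m)))
  (tree : SimpleGraph.IsTree T) (ordered : LevelOrdered T) (isParentArray : IsParentArray T parentArray) where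
  open SimpleGraph T
  open TreePairedDomination parentArray
  open Packing T using (Within3; packing-bound)
  open RootedTree T parentArray tree ordered isParentArray

  In Dom : State → Pos → Set
  In  s x = lookup (State.InPD s) x ≡ true
  Dom s x = lookup (State.DomByChild s) x ≡ true

  Free : State → Pos → Set
  Free s x = ¬ Dom s x × ¬ In s (parent x)

  -- Membership of `x` itself is not listed as an alternative: the field `in-covered` of the
  -- invariant makes it imply the two that are.
  Covered : State → Pos → Set
  Covered s x = Dom s x ⊎ In s (parent x)

  -- The alternative with parent x = 0 only serves x = 1.
  Sealed : State → Pos → Set
  Sealed s x = (parent x ≡ 0ᵖ ⊎ In s (parent x)) ×
               (parent (parent x) ≡ 0ᵖ ⊎ In s (parent (parent x)) × Dom s (parent (parent (parent x))))

  -- x was put into the set as the parent of a vertex y ≥ t.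
  Late : ℕ → State → Pos → Set
  Late t s x = (parent x ≡ 0ᵖ ⊎ In s (parent x)) × ∃[ y ] t ≤ toℕ y × depth y ≤ suc (depth x)

  -- This describes the state once all positions from `t` on have been treated. The `mate` fields
  -- carry the perfect matching, `dom-child` and `processed` carry domination, and the last five
  -- fields carry the packing together with its price of two vertices per witness.
  record Invariant (t : ℕ) (s : State) : Set where
    field
      mate       : Pos → Pos
      mate-in    : ∀ {x} → In s x → In s (mate x)
      mate-mate  : ∀ {x} → In s x → mate (mate x) ≡ x
      mate-adj   : ∀ {x} → In s x → Adjacent x (mate x)
      in-covered : ∀ {x} → In s x → Covered s x
      dom-child  : ∀ {x} → Dom s x → ∃[ c ] parent c ≡ x × In s c
      -- This separates vertices whose parent is already marked in `DomByChild` from those added as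
      -- the parent of a treated vertex, whose depth is then bounded below.
      in-origin  : ∀ {x} → In s x → Dom s (parent x) ⊎ Late t s x
      processed  : ∀ {v : Fin n} → t ≤ toℕ (suc v) → Covered s (suc v)
      witnesses  : List (Fin n)
      sparse     : AllPairs (λ u v → ¬ Within3 u v) witnesses
      above      : All (λ w → t ≤ toℕ (suc w)) witnesses
      sealed     : All (λ w → Sealed s (suc w)) witnesses
      size       : ∣ State.InPD s ∣ ≤ 2 * List.length witnesses

  Late-mono : ∀ {t s x} → Late (suc t) s x → Late t s x
  Late-mono (up , y , t<y , y≤x) = up , y , <⇒≤ t<y , y≤x

  In⇒≢0 : ∀ {t s x} → Invariant t s → In s x → x ≢ 0ᵖ
  In⇒≢0 inv x∈s = Adjacent⇒≢0 (Invariant.mate-adj inv x∈s)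

  -- By the level order `v` is no deeper than `w`, so the chains to a common ancestor have lengths
  -- `a ≤ b` with `a + b ≤ 3`: six pairs. `(0,0)` contradicts `v < w`. In the others the ancestor is
  -- the parent, grandparent or great-grandparent of `w`, and what `Sealed` says of it would make
  -- `v` covered.
  free-far : ∀ {t s v w} → Invariant t s → Free s (suc v) → Sealed s (suc w) → v < w → ¬ Within3 v w
  free-far {s = s} {v} {w} inv (¬dom , ¬in) (seal₁ , seal₂) v<w near
    with Within3⇒CommonAncestor near
  ... | a , b , ca@(eq , ≢0) , a+b≤3 = go a b eq ≢0 (CommonAncestor-depth {a} {b} ca (depth-mono (s≤s v<w))) a+b≤3
    where
    parent-in : parent (suc w) ≢ 0ᵖ → In s (parent (suc w))
    parent-in ≢0 = [ ⊥-elim ∘ ≢0 , id ]′ seal₁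
    grandparent-in : parent (parent (suc w)) ≢ 0ᵖ → In s (parent (parent (suc w)))
    grandparent-in ≢0 = [ ⊥-elim ∘ ≢0 , proj₁ ]′ seal₂
    not-in : ∀ {x} → suc v ≡ x → ¬ In s x
    not-in refl v∈s = [ ¬dom , ¬in ]′ (Invariant.in-covered inv v∈s)
    go : ∀ a b → ancestor a (suc v) ≡ ancestor b (suc w) → ancestor b (suc w) ≢ 0ᵖ → a ≤ b → a + b ≤ 3 → ⊥
    go 0 0 refl _  _ _ = <-irrefl refl v<w
    go 0 1 eq   ≢0 _ _ = not-in eq (parent-in ≢0)
    go 0 2 eq   ≢0 _ _ = not-in eq (grandparent-in ≢0)
    go 0 3 eq   ≢0 _ _ = [ (λ g≡0 → ≢0 (cong parent g≡0)) , (λ (_ , d) → ¬dom (subst (Dom s) (sym eq) d)) ]′ seal₂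
    go 1 1 eq   ≢0 _ _ = ¬in (subst (In s) (sym eq) (parent-in ≢0))
    go 1 2 eq   ≢0 _ _ = ¬in (subst (In s) (sym eq) (grandparent-in ≢0))
    go 0 (suc (suc (suc (suc _)))) _ _ _ (s≤s (s≤s (s≤s ())))
    go 1 (suc (suc (suc _))) _ _ _ (s≤s (s≤s (s≤s ())))
    go 1 0 _ _ () _
    go (suc (suc a)) 0 _ _ () _
    go (suc (suc a)) 1 _ _ (s≤s ()) _
    go (suc (suc zero)) (suc (suc b)) _ _ _ (s≤s (s≤s (s≤s ())))
    go (suc (suc (suc a))) (suc (suc b)) _ _ _ (s≤s (s≤s (s≤s a+b≤0))) = case subst (_≤ 0) (+-suc a (suc b)) a+b≤0 of λ ()

  processed-suc : ∀ s (v : Fin n) → Covered s (suc v) →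
    (∀ {u : Fin n} → suc (suc (toℕ v)) ≤ toℕ (suc u) → Covered s (suc u)) →
    ∀ {u : Fin n} → suc (toℕ v) ≤ toℕ (suc u) → Covered s (suc u)
  processed-suc s v covered processed {u} v≤u with m≤n⇒m<n∨m≡n v≤u
  ... | inj₁ v<u = processed v<u
  ... | inj₂ v≡u with toℕ-injective {i = suc v} {j = suc u} v≡u
  ...   | refl = covered

  skip : ∀ {s} (v : Fin n) → Covered s (suc v) → Invariant (suc (suc (toℕ v))) s → Invariant (suc (toℕ v)) s
  skip {s} v covered inv = record
    { Invariant inv hiding (in-origin; processed; above)
    ; in-origin = λ {x} → Sum.map id (Late-mono {s = s} {x}) ∘ in-origin
    ; processed = processed-suc s v covered processed
    ; above     = All.map <⇒≤ above
    }
    where open Invariant inv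

  module _ {inPD dom dom′ : Vec Bool (suc n)} {v : Fin n} {a b : Pos} where
    private
      s s′ : State
      s  = ⟨ inPD , dom ⟩
      s′ = ⟨ inPD [ a ]≔ true [ b ]≔ true , dom′ ⟩

    -- This is shared by step (a), step (b) and the final step of the algorithm. The free vertex `v`
    -- becomes the witness that pays for the pair `a`, `b`; by `free-far` it is far from all earlier
    -- witnesses.
    addPair : Invariant (suc (suc (toℕ v))) s → Free s (suc v) → Adjacent a b → ¬ In s a → ¬ In s b →
      (∀ {x} → Dom s x → Dom s′ x) →
      (∀ {x} → Dom s′ x → Dom s x ⊎ x ≡ parent a ⊎ x ≡ parent b) →
      Covered s′ a → Covered s′ b →
      Dom s′ (parent a) ⊎ Late (suc (toℕ v)) s′ a → Dom s′ (parent b) ⊎ Late (suc (toℕ v)) s′ b →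
      Covered s′ (suc v) → Sealed s′ (suc v) →
      Invariant (suc (toℕ v)) s′
    addPair inv free adj a∉ b∉ dom-⊇ dom⁻ covered-a covered-b origin-a origin-b covered-v sealed-v = record
      { mate       = rematch
      ; mate-in    = mate-in′
      ; mate-mate  = mate-mate′
      ; mate-adj   = mate-adj′
      ; in-covered = in-covered′
      ; dom-child  = dom-child′
      ; in-origin  = in-origin′
      ; processed  = processed-suc s′ v covered-v (Sum.map dom-⊇ (set-pair-⊇ inPD a b) ∘ processed)
      ; witnesses  = v ∷ witnesses
      ; sparse     = All.zipWith (λ (v<w , seal) → free-far inv free seal (≤-pred v<w)) (above , sealed) ∷ sparse
      ; above      = ≤-refl ∷ All.map <⇒≤ above
      ; sealed     = sealed-v ∷ All.map (λ {w} → sealed-mono {suc w}) sealed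
      ; size       = ≤-trans (∣set-true∣ (inPD [ a ]≔ true) b) (≤-trans (s≤s (≤-trans (∣set-true∣ inPD a) (s≤s size)))
                       (≤-reflexive (sym (*-suc 2 (List.length witnesses)))))
      }
      where
      open Invariant inv
      open Rematch a b mate

      a≢b : a ≢ b
      a≢b = Adjacent⇒≢ adj

      rematch-old : ∀ {x} → In s x → rematch x ≡ mate x
      rematch-old x∈ = rematch-other (λ { refl → a∉ x∈ }) (λ { refl → b∉ x∈ })

      mate-in′ : ∀ {x} → In s′ x → In s′ (rematch x)
      mate-in′ x∈ with set-pair⁻ inPD a b x∈
      ... | inj₁ refl        = subst (In s′) (sym rematch-a) (set-pair-∋ʳ inPD a b)
      ... | inj₂ (inj₁ refl) = subst (In s′) (sym (rematch-b a≢b)) (set-pair-∋ˡ inPD a b)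
      ... | inj₂ (inj₂ x∈s)  = subst (In s′) (sym (rematch-old x∈s)) (set-pair-⊇ inPD a b (mate-in x∈s))

      mate-mate′ : ∀ {x} → In s′ x → rematch (rematch x) ≡ x
      mate-mate′ x∈ with set-pair⁻ inPD a b x∈
      ... | inj₁ refl        = trans (cong rematch rematch-a) (rematch-b a≢b)
      ... | inj₂ (inj₁ refl) = trans (cong rematch (rematch-b a≢b)) rematch-a
      -- The old mate lies in the old set, hence is neither `a` nor `b`, so the second application
      -- is an old one too.
      ... | inj₂ (inj₂ x∈s)  =
        trans (cong rematch (rematch-old x∈s)) (trans (rematch-old (mate-in x∈s)) (mate-mate x∈s))

      mate-adj′ : ∀ {x} → In s′ x → Adjacent x (rematch x)
      mate-adj′ {x} x∈ with set-pair⁻ inPD a b x∈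
      ... | inj₁ refl        = subst (Adjacent a) (sym rematch-a) adj
      ... | inj₂ (inj₁ refl) = subst (Adjacent b) (sym (rematch-b a≢b)) (Adjacent-sym {a} {b} adj)
      ... | inj₂ (inj₂ x∈s)  = subst (Adjacent x) (sym (rematch-old x∈s)) (mate-adj x∈s)

      in-covered′ : ∀ {x} → In s′ x → Covered s′ x
      in-covered′ x∈ with set-pair⁻ inPD a b x∈
      ... | inj₁ refl        = covered-a
      ... | inj₂ (inj₁ refl) = covered-b
      ... | inj₂ (inj₂ x∈s)  = Sum.map dom-⊇ (set-pair-⊇ inPD a b) (in-covered x∈s)

      dom-child′ : ∀ {x} → Dom s′ x → ∃[ c ] parent c ≡ x × In s′ c
      dom-child′ x-dom with dom⁻ x-dom
      ... | inj₁ x-dom-s      = let c , eq , c∈s = dom-child x-dom-s in c , eq , set-pair-⊇ inPD a b c∈s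
      ... | inj₂ (inj₁ x≡pa) = a , sym x≡pa , set-pair-∋ˡ inPD a b
      ... | inj₂ (inj₂ x≡pb) = b , sym x≡pb , set-pair-∋ʳ inPD a b

      in-origin′ : ∀ {x} → In s′ x → Dom s′ (parent x) ⊎ Late (suc (toℕ v)) s′ x
      in-origin′ x∈ with set-pair⁻ inPD a b x∈
      ... | inj₁ refl        = origin-a
      ... | inj₂ (inj₁ refl) = origin-b
      ... | inj₂ (inj₂ x∈s)  =
        Sum.map dom-⊇ (λ (up , y , v<y , y≤x) → Sum.map id (set-pair-⊇ inPD a b) up , y , <⇒≤ v<y , y≤x) (in-origin x∈s)

      sealed-mono : ∀ {x} → Sealed s x → Sealed s′ x
      sealed-mono (seal₁ , seal₂) =
        Sum.map id (set-pair-⊇ inPD a b) seal₁ ,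
        Sum.map id (λ (g∈ , d) → set-pair-⊇ inPD a b g∈ , dom-⊇ d) seal₂

  false⇒≢true : ∀ {b} → b ≡ false → b ≢ true
  false⇒≢true refl ()

  module _ (i : Pos) (inPD dom : Vec Bool (suc n)) where
    private
      s : State
      s = ⟨ inPD , dom ⟩
      p g : Pos
      p = parent i
      g = parent p

    conditionA conditionB : Bool
    conditionA = not (lookup dom i) ∧ not (lookup inPD p) ∧ not ⌊ p ≟ 1ᵖ ⌋ ∧ not (lookup inPD g)
    conditionB = not (lookup dom i) ∧ not (lookup inPD p) ∧ (⌊ p ≟ 1ᵖ ⌋ ∨ lookup inPD g)

    stepA-true : conditionA ≡ true →
      stepA i s ≡ ⟨ inPD [ p ]≔ true [ g ]≔ true , dom [ g ]≔ true [ parent g ]≔ true ⟩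
    stepA-true eq rewrite eq = refl

    stepA-false : conditionA ≡ false → stepA i s ≡ s
    stepA-false eq rewrite eq = refl

    stepB-true : ∀ {i₁} → conditionB ≡ true → largestFreeChild inPD p ≡ just i₁ →
      stepB i s ≡ ⟨ inPD [ p ]≔ true [ i₁ ]≔ true , dom [ p ]≔ true ⟩
    stepB-true eq eq₁ rewrite eq | eq₁ = refl

    stepB-false : conditionB ≡ false → stepB i s ≡ s
    stepB-false eq rewrite eq = refl

    -- Once step (a) has put `p` into the set, step (b) of the same pass is idle.
    stepB-parent∈ : lookup inPD p ≡ true → stepB i s ≡ s
    stepB-parent∈ p∈ = stepB-false
      (subst (λ b → not (lookup dom i) ∧ not b ∧ (⌊ p ≟ 1ᵖ ⌋ ∨ lookup inPD g) ≡ false) (sym p∈) (∧-zeroʳ _))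

  free∉ : ∀ {t s x} → Invariant t s → Free s x → ¬ In s x
  free∉ inv (¬dom , ¬in) x∈ = [ ¬dom , ¬in ]′ (Invariant.in-covered inv x∈)

  -- One pass of the loop.

  module Step (k : Fin (suc m)) (inPD dom : Vec Bool (suc n)) where
    v : Fin n
    v = suc k
    i p g : Pos
    i = suc v
    p = parent i
    g = parent p
    s : State
    s = ⟨ inPD , dom ⟩

    p≢0 : p ≢ 0ᵖ
    p≢0 = parent≢0 {i} (λ ()) (λ ())

    depth-i : depth i ≡ suc (depth p)
    depth-i = depth-parent {i} (λ ())

    caseA : Invariant (suc (suc (toℕ v))) s → Free s i → p ≢ 1ᵖ → ¬ In s g →
      Invariant (suc (toℕ v)) ⟨ inPD [ p ]≔ true [ g ]≔ true , dom [ g ]≔ true [ parent g ]≔ true ⟩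
    caseA inv free p≢1 g∉ = addPair inv free p~g (proj₂ free) g∉ dom-⊇ dom⁻
      (inj₂ g∈) (inj₁ g-dom) (inj₁ g-dom) (inj₁ gg-dom) (inj₂ p∈) (inj₂ p∈ , inj₂ (g∈ , gg-dom))
      where
      s′ : State
      s′ = ⟨ inPD [ p ]≔ true [ g ]≔ true , dom [ g ]≔ true [ parent g ]≔ true ⟩
      p~g : Adjacent p g
      p~g = Adjacent-parent refl p≢0 (parent≢0 p≢0 p≢1)
      p∈ : In s′ p
      p∈ = set-pair-∋ˡ inPD p g
      g∈ : In s′ g
      g∈ = set-pair-∋ʳ inPD p g
      g-dom : Dom s′ g
      g-dom = set-pair-∋ˡ dom g (parent g)
      gg-dom : Dom s′ (parent g)
      gg-dom = set-pair-∋ʳ dom g (parent g)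
      dom-⊇ : ∀ {x} → Dom s x → Dom s′ x
      dom-⊇ = set-pair-⊇ dom g (parent g)
      dom⁻ : ∀ {x} → Dom s′ x → Dom s x ⊎ x ≡ g ⊎ x ≡ parent g
      dom⁻ = [ inj₂ ∘ inj₁ , [ inj₂ ∘ inj₂ , inj₁ ]′ ]′ ∘ set-pair⁻ dom g (parent g)

    -- Step (b) marks only `p`, so the part of `Sealed` about the grandparent must come from the
    -- earlier state: either `p` is the root and `g` the dummy, or `g` was in the set already and
    -- `gg-dom` applies.
    caseB : ∀ {i₁} → Invariant (suc (suc (toℕ v))) s → Free s i → p ≡ 1ᵖ ⊎ In s g →
      parent i₁ ≡ p → ¬ In s i₁ →
      Invariant (suc (toℕ v)) ⟨ inPD [ p ]≔ true [ i₁ ]≔ true , dom [ p ]≔ true ⟩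
    caseB {i₁} inv free p≡1⊎g∈ pi₁ i₁∉ = addPair inv free p~i₁ (proj₂ free) i₁∉ dom-⊇ dom⁻
      -- `p` enters as `Late`, with its child `i`, one level deeper, as the treated vertex.
      (inj₁ p-dom) (inj₂ (subst (In s′) (sym pi₁) p∈)) (inj₂ (g-up , i , ≤-refl , ≤-reflexive depth-i))
      (inj₁ (subst (Dom s′) (sym pi₁) p-dom)) (inj₂ p∈) (inj₂ p∈ , Sum.map id (λ g∈ → ⊇ g∈ , dom-⊇ (gg-dom g∈)) g≡0⊎g∈)
      where
      s′ : State
      s′ = ⟨ inPD [ p ]≔ true [ i₁ ]≔ true , dom [ p ]≔ true ⟩
      p~i₁ : Adjacent p i₁
      p~i₁ = Adjacent-sym {i₁} {p} (Adjacent-parent {i₁} pi₁ (λ { refl → p≢0 (sym pi₁) }) p≢0)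
      p∈ : In s′ p
      p∈ = set-pair-∋ˡ inPD p i₁
      p-dom : Dom s′ p
      p-dom = set-true-∋ dom p
      ⊇ : ∀ {x} → In s x → In s′ x
      ⊇ = set-pair-⊇ inPD p i₁
      dom-⊇ : ∀ {x} → Dom s x → Dom s′ x
      dom-⊇ = set-true-⊇ dom p
      dom⁻ : ∀ {x} → Dom s′ x → Dom s x ⊎ x ≡ g ⊎ x ≡ parent i₁
      dom⁻ d = [ (λ x≡p → inj₂ (inj₂ (trans x≡p (sym pi₁)))) , inj₁ ]′ (set-true⁻ dom p d)
      g≡0⊎g∈ : g ≡ 0ᵖ ⊎ In s g
      g≡0⊎g∈ = Sum.map (λ p≡1 → trans (cong parent p≡1) parent-1) id p≡1⊎g∈
      g-up : g ≡ 0ᵖ ⊎ In s′ g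
      g-up = Sum.map id ⊇ g≡0⊎g∈
      -- A vertex of depth at most depth g + 1 has not been processed yet, so
      -- g is in the set as the grandparent of a processed vertex.
      gg-dom : In s g → Dom s (parent g)
      gg-dom g∈ with Invariant.in-origin inv g∈
      ... | inj₁ d = d
      ... | inj₂ (_ , y , v<y , y≤g) = ⊥-elim (1+n≰n (begin
        suc (suc (depth g)) ≡⟨ cong suc (depth-parent p≢0) ⟨
        suc (depth p)       ≡⟨ depth-i ⟨
        depth i             ≤⟨ depth-mono v<y ⟩
        depth y             ≤⟨ y≤g ⟩
        suc (depth g)       ∎))
        where open ≤-Reasoning

    -- `i` itself passes the filter, so the filtered list has a last entry.
    freeChild : Free s i → ¬ In s i → ∃[ i₁ ] largestFreeChild inPD p ≡ just i₁ × parent i₁ ≡ p × ¬ In s i₁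
    freeChild free i∉ =
      let P? = λ j → (parent j ≟ p) ×-dec (lookup inPD j Bool.≟ false)
          i₁ , eq , i₁∈ = last-∈ (∈-filter⁺ P? (∈-tabulate⁺ {f = suc} v) (refl , ¬-not i∉))
          _ , pi₁ , i₁∉ = ∈-filter⁻ P? {xs = tabulate suc} i₁∈
      in i₁ , eq , pi₁ , false⇒≢true i₁∉

    -- Neither step fires when `i` is covered; for a free `i` exactly one does, according to whether
    -- `p` is the root or `g` is in the set.
    conditions :
      Covered s i × conditionA i inPD dom ≡ false × conditionB i inPD dom ≡ false ⊎
      Free s i × p ≢ 1ᵖ × ¬ In s g × conditionA i inPD dom ≡ true ⊎
      Free s i × (p ≡ 1ᵖ ⊎ In s g) × conditionA i inPD dom ≡ false × conditionB i inPD dom ≡ true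
    conditions with lookup dom i | lookup inPD p | p ≟ 1ᵖ | lookup inPD g
    ... | true  | _     | _       | _     = inj₁ (inj₁ refl , refl , refl)
    ... | false | true  | _       | _     = inj₁ (inj₂ refl , refl , refl)
    ... | false | false | yes p≡1 | _     = inj₂ (inj₂ (((λ ()) , λ ()) , inj₁ p≡1 , refl , refl))
    ... | false | false | no p≢1  | true  = inj₂ (inj₂ (((λ ()) , λ ()) , inj₂ refl , refl , refl))
    ... | false | false | no p≢1  | false = inj₂ (inj₁ (((λ ()) , λ ()) , p≢1 , (λ ()) , refl))

    step : Invariant (suc (suc (toℕ v))) s → Invariant (suc (toℕ v)) (stepB i (stepA i s))
    step inv with conditions
    ... | inj₁ (covered , notA , notB) =
      subst (Invariant _) (sym (trans (cong (stepB i) (stepA-false i inPD dom notA)) (stepB-false i inPD dom notB)))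
        (skip v covered inv)
    ... | inj₂ (inj₁ (free , p≢1 , g∉ , isA)) =
      subst (Invariant _) (sym (trans (cong (stepB i) (stepA-true i inPD dom isA)) (stepB-parent∈ i _ _ p∈)))
        (caseA inv free p≢1 g∉)
      where
      p∈ : lookup (inPD [ p ]≔ true [ g ]≔ true) p ≡ true
      p∈ = set-pair-∋ˡ inPD p g
    ... | inj₂ (inj₂ (free , p≡1⊎g∈ , notA , isB)) =
      let i₁ , eq , pi₁ , i₁∉ = freeChild free (free∉ inv free) in
      subst (Invariant _) (sym (trans (cong (stepB i) (stepA-false i inPD dom notA)) (stepB-true i inPD dom isB eq)))
        (caseB inv free p≡1⊎g∈ pi₁ i₁∉)

  -- From the initial state through the loop to the treatment of the root.

  initial-invariant : Invariant (suc n) initial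
  initial-invariant = record
    { mate       = id
    ; mate-in    = λ {x} x∈ → ⊥-elim (none x x∈)
    ; mate-mate  = λ _ → refl
    ; mate-adj   = λ {x} x∈ → ⊥-elim (none x x∈)
    ; in-covered = λ {x} x∈ → ⊥-elim (none x x∈)
    ; dom-child  = λ {x} x∈ → ⊥-elim (none x x∈)
    ; in-origin  = λ {x} x∈ → ⊥-elim (none x x∈)
    ; processed  = λ {v} n<v → ⊥-elim (<-irrefl refl (≤-trans n<v (toℕ<n v)))
    ; witnesses  = []
    ; sparse     = []
    ; above      = []
    ; sealed     = []
    ; size       = ≤-reflexive (∣replicate-false∣ (suc n))
    }
    where
    none : ∀ x → lookup (replicate (suc n) false) x ≢ true
    none x = false⇒≢true (lookup-replicate x false)

  loop-invariant : Invariant 2 loop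
  -- Entry `j` of the list is position `j + 2`, whence the shift by two.
  loop-invariant = foldr-tabulate-induct (λ j → Invariant (suc (suc j))) (λ i s → stepB i (stepA i s))
    (λ k → suc (suc k)) initial-invariant (λ { k {⟨ inPD , dom ⟩} → Step.step k inPD dom })

  -- The root is treated as one more vertex. Its parent is the dummy, which is never in the set, so
  -- it is free exactly when its `DomByChild` entry is false, and then it is the last witness.
  finish-invariant : ∀ s → Invariant 2 s → Invariant 1 (finish s)
  finish-invariant s@(⟨ inPD , dom ⟩) inv with lookup dom 1ᵖ in 1-dom
  ... | true  = skip zero (inj₁ 1-dom) inv
  ... | false = addPair inv (¬1-dom , ¬0∈) (Adjacent-sym {2ᵖ} {1ᵖ} (Adjacent-parent {2ᵖ} parent-2 (λ ()) λ ()))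
      1∉ 2∉ (set-true-⊇ dom 1ᵖ) dom⁻
      (inj₁ 1-dom′) (inj₂ (subst (In s′) (sym parent-2) 1∈)) (inj₂ (inj₁ parent-1 , 1ᵖ , ≤-refl , n≤1+n _))
      (inj₁ (subst (Dom s′) (sym parent-2) 1-dom′)) (inj₁ 1-dom′)
      (inj₁ parent-1 , inj₁ (cong parent parent-1))
    where
    s′ : State
    s′ = ⟨ inPD [ 1ᵖ ]≔ true [ 2ᵖ ]≔ true , dom [ 1ᵖ ]≔ true ⟩
    ¬1-dom : ¬ Dom s 1ᵖ
    ¬1-dom = false⇒≢true 1-dom
    ¬0∈ : ¬ In s (parent 1ᵖ)
    ¬0∈ p∈ = In⇒≢0 inv p∈ parent-1
    1∉ : ¬ In s 1ᵖ
    1∉ = free∉ inv (¬1-dom , ¬0∈)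
    -- Either origin of a 2 in the set would have its parent, the root, marked in `DomByChild` or in
    -- the set, and both are excluded.
    2∉ : ¬ In s 2ᵖ
    2∉ 2∈ with Invariant.in-origin inv 2∈
    ... | inj₁ d                = ¬1-dom (subst (Dom s) parent-2 d)
    ... | inj₂ (inj₁ p≡0 , _) = case trans (sym parent-2) p≡0 of λ ()
    ... | inj₂ (inj₂ p∈ , _)  = 1∉ (subst (In s) parent-2 p∈)
    1-dom′ : Dom s′ 1ᵖ
    1-dom′ = set-true-∋ dom 1ᵖ
    1∈ : In s′ 1ᵖ
    1∈ = set-pair-∋ˡ inPD 1ᵖ 2ᵖ
    dom⁻ : ∀ {x} → Dom s′ x → Dom s x ⊎ x ≡ parent 1ᵖ ⊎ x ≡ parent 2ᵖ
    dom⁻ d = [ (λ x≡1 → inj₂ (inj₂ (trans x≡1 (sym parent-2)))) , inj₁ ]′ (set-true⁻ dom 1ᵖ d)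

  -- Domination, matching and optimality read off the final invariant.

  module _ {s : State} (inv : Invariant 1 s) where
    open Invariant inv

    private
      S : Subset n
      S = tail (State.InPD s)

    lookup-tail : ∀ {k} (p : Subset (suc k)) v → lookup (tail p) v ≡ lookup p (suc v)
    lookup-tail (_ ∷ _) v = refl

    ∈⇒In : ∀ {v} → v ∈ S → In s (suc v)
    ∈⇒In v∈ = trans (sym (lookup-tail (State.InPD s) _)) ([]=⇒lookup v∈)

    In⇒∈ : ∀ {v} → In s (suc v) → v ∈ S
    In⇒∈ v∈ = lookup⇒[]= _ S (trans (lookup-tail (State.InPD s) _) v∈)

    dominating : Dominating T S
    dominating v _ with processed {v} (s≤s z≤n)
    ... | inj₁ d with dom-child d
    ...   | zero  , eq , c∈ = ⊥-elim (In⇒≢0 inv c∈ refl)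
    ...   | suc c , eq , c∈ = c , In⇒∈ c∈ , ~-sym (parent⇒~ eq)
    dominating v _ | inj₂ p∈ with parent (suc v) in eq
    ...   | zero  = ⊥-elim (In⇒≢0 inv p∈ refl)
    ...   | suc p = p , In⇒∈ p∈ , parent⇒~ eq

    matching : SimpleGraph.PerfectMatching (induced T S)
    matching = record
      { M       = λ (u , _) (v , _) → mate (suc u) ≡ suc v
      ; M-sym   = λ {(u , u∈)} eq → trans (cong mate (sym eq)) (mate-mate (∈⇒In u∈))
      ; M⊆~     = λ {(u , u∈)} eq → subst (Adjacent (suc u)) eq (mate-adj (∈⇒In u∈))
      ; perfect = λ (u , u∈) → let v , eq = partner (mate-in (∈⇒In u∈)) in
          (v , In⇒∈ (subst (In s) eq (mate-in (∈⇒In u∈)))) , eq , λ eq′ → subset-≡ (suc-injective (trans (sym eq) eq′))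
      }
      where
      partner : ∀ {x} → In s x → ∃[ v ] x ≡ suc v
      partner {zero}  x∈ = ⊥-elim (In⇒≢0 inv x∈ refl)
      partner {suc v} _  = v , refl

    optimal : IsγprSet T S
    optimal = (dominating , matching) , (S , (dominating , matching) , refl) ,
      -- Twice the number of witnesses lies between the size of the output and that of any PD-set
      -- `S′`.
      λ { (S′ , pd , refl) → ≤-trans (∣tail∣ (State.InPD s)) (≤-trans size (packing-bound pd witnesses sparse)) }

theorem1 : ∀ (m : ℕ) (T : SimpleGraph (Fin (suc (suc m)))) (parent : ParentArray (suc (suc m))) →
    SimpleGraph.IsTree T →
    LevelOrdered T →
    IsParentArray T parent →
    IsγprSet T (treePairedDomination parent)
theorem1 m T parent tree ordered isParentArray = optimal (finish-invariant _ loop-invariant)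
  where open Correctness T parent tree ordered isParentArray
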